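{- Let $G$ be a graph with maximum degree $\Delta$ and with $v_{\mathrm{odd}}$ vertices of odd degree. Then $E(G)$ can be odd-covered with at most $\Delta+\frac{v_{\mathrm{odd}}}{2}$ paths, i.e. $p_2(G)\le \Delta+\frac{v_{\mathrm{odd}}}{2}$.
   Context: All graphs are finite and simple. A path odd-cover of a graph $G=(V,E)$ is a collection of paths in the complete graph on $V$ whose edge sets have symmetric difference equal to $E$; $p_2(G)$ is its minimum cardinality. -}

module Defs where

open import Data.Nat using (ℕ; zero; suc; _+_; _⊔_)
open import Data.Bool using (Bool; true; false; _∨_; _∧_; not)
open import Data.Fin using (Fin; _≟_)
open import Data.List using (List; []; _∷_; foldr; length; filter)
open import Data.List.Relation.Unary.Unique.Propositional using (Unique)
open import Relation.Binary.PropositionalEquality using (_≡_)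
open import Relation.Nullary.Decidable using (⌊_⌋)
open import Relation.Nullary using (¬_)
open import Data.List.Base using (map)
open import Data.Fin.Base using (toℕ)
open import Data.List using (allFin)

record Graph (n : ℕ) : Set where
  field
    adj   : Fin n → Fin n → Bool
    sym   : ∀ u v → adj u v ≡ adj v u
    irrefl : ∀ u → adj u u ≡ false
open Graph public

countB : {A : Set} → (A → Bool) → List A → ℕ
countB p [] = 0
countB p (x ∷ xs) with p x
... | true  = suc (countB p xs)
... | false = countB p xs

isOdd : ℕ → Bool
isOdd zero = false
isOdd (suc k) = not (isOdd k)

degree : ∀ {n} → Graph n → Fin n → ℕ
degree G v = countB (adj G v) (allFin _)

maxDegree : ∀ {n} → Graph n → ℕ
maxDegree G = foldr (λ v m → degree G v ⊔ m) 0 (allFin _)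

vOdd : ∀ {n} → Graph n → ℕ
vOdd G = countB (λ v → isOdd (degree G v)) (allFin _)

-- A path in the complete graph on Fin n: a sequence of pairwise distinct
-- vertices; its edges are the consecutive pairs.
record Path (n : ℕ) : Set where
  field
    verts    : List (Fin n)
    distinct : Unique verts
open Path public

hasEdge : ∀ {n} → Fin n → Fin n → List (Fin n) → Bool
hasEdge u v [] = false
hasEdge u v (x ∷ []) = false
hasEdge u v (x ∷ y ∷ xs) =
  ((⌊ x ≟ u ⌋ ∧ ⌊ y ≟ v ⌋) ∨ (⌊ x ≟ v ⌋ ∧ ⌊ y ≟ u ⌋)) ∨ hasEdge u v (y ∷ xs)

-- A collection of paths is a path odd-cover of G if the symmetric difference
-- of their edge sets is E(G): each pair {u,v} (u ≠ v) lies in an odd number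
-- of the paths iff uv is an edge of G.
IsPathOddCover : ∀ {n} → Graph n → List (Path n) → Set
IsPathOddCover {n} G ps =
  ∀ (u v : Fin n) → ¬ (u ≡ v) →
    isOdd (countB (λ P → hasEdge u v (verts P)) ps) ≡ adj G u v

{-# OPTIONS --safe #-}
-- Join the odd vertices in pairs by a set M of extra edges. In G + M every degree is even, so it
-- has an orientation with equal in- and out-degrees, at most k = ⌊t/2⌋ where t bounds the degrees
-- of G + M. After padding with loops, König's edge colouring theorem for the bipartite graph of
-- (source, target) pairs splits the arcs into k permutations. A permutation with cycles
-- aᵢ → … → bᵢ → aᵢ is the sum modulo 2 of the two paths
--   a₁ … b₁ a₂ … b₂ a₃ …   and   a₁ b₁ a₂ b₂ a₃ …,
-- and M is cancelled by one-edge paths. If M is empty, take t = Δ. Otherwise take t = Δ + 1, and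
-- choose one edge of M as the closing arc b₁ → a₁ of the first cycle of its permutation: dropping
-- it from the second path saves the one-edge path for it.
module Submission where

open import Defs
open import Algebra.Properties.CommutativeSemigroup using (interchange; x∙yz≈y∙xz)
open import Data.Bool using (Bool; true; false; _∨_; _∧_; not; _xor_)
open import Data.Bool.Properties using (not-involutive; ∨-comm; ∧-comm; xor-same; not-distribˡ-xor)
open import Data.Fin using (Fin)
import Data.Fin as Fin
import Data.Fin.Properties as Fin
open import Data.List using (List; []; _∷_; _++_; map; concat; length; replicate; filterᵇ; allFin; foldr;
  cartesianProduct; concatMap)
open import Data.List.Properties using (++-assoc; ++-identityʳ; length-++; length-map; concatMap-++; ∷-injective)
open import Data.List.Membership.Propositional using (_∈_; _∉_)
open import Data.List.Membership.Propositional.Properties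
  using (∈-allFin; ∈-∃++; ∈-++⁻; ∈-++⁺ˡ; ∈-++⁺ʳ; ∈-map⁺; ∈-map⁻)
open import Data.List.Relation.Binary.Permutation.Propositional
  using (_↭_; refl; prep; swap; trans; ↭-refl; ↭-sym; ↭-trans; ↭-reflexive; ↭⇒↭ₛ; module PermutationReasoning)
open import Data.List.Relation.Binary.Permutation.Propositional.Properties
  using (∈-resp-↭; ↭-length; ++⁺ˡ; ++⁺ʳ; shift; shifts; drop-∷; map⁺; ↭-map-inv; All-resp-↭)
import Data.List.Relation.Binary.Permutation.Setoid.Properties as PermutationSetoid
open import Data.List.Relation.Binary.Subset.Propositional using (_⊆_)
open import Data.List.Relation.Binary.Subset.Propositional.Properties using (∷⁺ʳ; ∈-∷⁺ʳ)
open import Data.List.Relation.Unary.All as All using (All; []; _∷_)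
open import Data.List.Relation.Unary.AllPairs using ([]; _∷_)
open import Data.List.Relation.Unary.Any using (here; there)
open import Data.List.Relation.Unary.Unique.Propositional using (Unique; tail)
open import Data.List.Relation.Unary.Unique.Propositional.Properties using (allFin⁺)
open import Data.Nat using (ℕ; zero; suc; _+_; _*_; _∸_; _/_; ⌊_/2⌋; _≤_; _<_; _⊔_; z≤n; s≤s)
open import Data.Nat.DivMod using (m*n/n≡m)
open import Data.Nat.Properties hiding (_≟_)
open import Data.Product using (Σ; ∃; ∃₂; _×_; _,_; proj₁; proj₂)
import Data.Product as Product
open import Data.Sum using (_⊎_; inj₁; inj₂; [_,_]′)
open import Data.Sum.Properties using (≡-dec)
open import Function using (_∘_)
open import Relation.Binary.Bundles using (Setoid)
open import Relation.Binary.Definitions using (DecidableEquality)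
open import Relation.Binary.PropositionalEquality
  using (_≡_; _≢_; cong; cong₂; subst; subst₂; module ≡-Reasoning)
import Relation.Binary.PropositionalEquality as ≡
import Relation.Binary.Reasoning.Setoid as SetoidReasoning
open import Relation.Nullary.Decidable using (⌊_⌋)
open import Relation.Nullary using (Dec; does; yes; no; contradiction)

private variable
  A B : Set

-- Finite sums of natural numbers over lists.

ι : Bool → ℕ
ι false = 0
ι true  = 1

∑ : (A → ℕ) → List A → ℕ
∑ f []       = 0
∑ f (x ∷ xs) = f x + ∑ f xs

∑-cong : {f g : A → ℕ} → (∀ x → f x ≡ g x) → ∀ xs → ∑ f xs ≡ ∑ g xs
∑-cong f≗g []       = ≡.refl
∑-cong f≗g (x ∷ xs) = cong₂ _+_ (f≗g x) (∑-cong f≗g xs)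

∑-++ : (f : A → ℕ) (xs ys : List A) → ∑ f (xs ++ ys) ≡ ∑ f xs + ∑ f ys
∑-++ f []       ys = ≡.refl
∑-++ f (x ∷ xs) ys = ≡.trans (cong (f x +_) (∑-++ f xs ys)) (≡.sym (+-assoc (f x) _ _))

∑-map : (f : B → ℕ) (g : A → B) (xs : List A) → ∑ f (map g xs) ≡ ∑ (f ∘ g) xs
∑-map f g []       = ≡.refl
∑-map f g (x ∷ xs) = cong (f (g x) +_) (∑-map f g xs)

∑-concat : (f : A → ℕ) (xss : List (List A)) → ∑ f (concat xss) ≡ ∑ (∑ f) xss
∑-concat f []         = ≡.refl
∑-concat f (xs ∷ xss) = ≡.trans (∑-++ f xs (concat xss)) (cong (∑ f xs +_) (∑-concat f xss))

∑-concatMap : (f : B → ℕ) (g : A → List B) (xs : List A) →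
  ∑ f (concatMap g xs) ≡ ∑ (λ x → ∑ f (g x)) xs
∑-concatMap f g xs = ≡.trans (∑-concat f (map g xs)) (∑-map (∑ f) g xs)

∑-↭ : (f : A → ℕ) {xs ys : List A} → xs ↭ ys → ∑ f xs ≡ ∑ f ys
∑-↭ f refl         = ≡.refl
∑-↭ f (prep x p)   = cong (f x +_) (∑-↭ f p)
∑-↭ f (swap x y p) = ≡.trans (x∙yz≈y∙xz +-commutativeSemigroup (f x) (f y) _)
                             (cong (λ s → f y + (f x + s)) (∑-↭ f p))
∑-↭ f (trans p q)  = ≡.trans (∑-↭ f p) (∑-↭ f q)

∑-0 : (xs : List A) → ∑ (λ _ → 0) xs ≡ 0
∑-0 []       = ≡.refl
∑-0 (x ∷ xs) = ∑-0 xs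

∑-+ : (f g : A → ℕ) (xs : List A) → ∑ (λ x → f x + g x) xs ≡ ∑ f xs + ∑ g xs
∑-+ f g []       = ≡.refl
∑-+ f g (x ∷ xs) = ≡.trans (cong (f x + g x +_) (∑-+ f g xs))
                           (interchange +-commutativeSemigroup (f x) (g x) (∑ f xs) (∑ g xs))

∑-* : (m : ℕ) (f : A → ℕ) (xs : List A) → ∑ (λ x → m * f x) xs ≡ m * ∑ f xs
∑-* m f []       = ≡.sym (*-zeroʳ m)
∑-* m f (x ∷ xs) = ≡.trans (cong (m * f x +_) (∑-* m f xs)) (≡.sym (*-distribˡ-+ m (f x) _))

∑-exchange : (f : A → B → ℕ) (xs : List A) (ys : List B) →
  ∑ (λ x → ∑ (f x) ys) xs ≡ ∑ (λ y → ∑ (λ x → f x y) xs) ys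
∑-exchange f []       ys = ≡.sym (∑-0 ys)
∑-exchange f (x ∷ xs) ys = ≡.trans (cong (∑ (f x) ys +_) (∑-exchange f xs ys))
                                   (≡.sym (∑-+ (f x) _ ys))

∑-cartesianProduct : (f : A × B → ℕ) (xs : List A) (ys : List B) →
  ∑ f (cartesianProduct xs ys) ≡ ∑ (λ x → ∑ (λ y → f (x , y)) ys) xs
∑-cartesianProduct f []       ys = ≡.refl
∑-cartesianProduct f (x ∷ xs) ys =
  ≡.trans (∑-++ f (map (x ,_) ys) _) (cong₂ _+_ (∑-map f (x ,_) ys) (∑-cartesianProduct f xs ys))

∑-filterᵇ : (f : A → ℕ) (p : A → Bool) (xs : List A) →
  ∑ f (filterᵇ p xs) ≡ ∑ (λ x → ι (p x) * f x) xs
∑-filterᵇ f p []       = ≡.refl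
∑-filterᵇ f p (x ∷ xs) with p x
... | true  = cong₂ _+_ (≡.sym (+-identityʳ (f x))) (∑-filterᵇ f p xs)
... | false = ∑-filterᵇ f p xs

∑-replicate : (f : A → ℕ) (m : ℕ) (x : A) → ∑ f (replicate m x) ≡ m * f x
∑-replicate f zero    x = ≡.refl
∑-replicate f (suc m) x = cong (f x +_) (∑-replicate f m x)

countB-∑ : (p : A → Bool) (xs : List A) → countB p xs ≡ ∑ (ι ∘ p) xs
countB-∑ p []       = ≡.refl
countB-∑ p (x ∷ xs) with p x
... | true  = cong suc (countB-∑ p xs)
... | false = countB-∑ p xs

-- Lists up to rearrangement.

concat-↭ : {xss yss : List (List A)} → xss ↭ yss → concat xss ↭ concat yss
concat-↭ refl           = refl
concat-↭ (prep xs p)    = ++⁺ˡ xs (concat-↭ p)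
concat-↭ (swap xs ys p) = ↭-trans (++⁺ˡ xs (++⁺ˡ ys (concat-↭ p))) (shifts xs ys)
concat-↭ (trans p q)    = trans (concat-↭ p) (concat-↭ q)

∈⇒↭ : {x : A} {xs : List A} → x ∈ xs → ∃ λ ys → xs ↭ x ∷ ys
∈⇒↭ x∈xs with ∈-∃++ x∈xs
... | ys , zs , ≡.refl = ys ++ zs , shift _ ys zs

-- Cancels `x` on the side where it occurs; applied to an orientation, this tells whether an edge
-- was kept or reversed.
++-uncons : ∀ {x : A} (xs ys : List A) {zs} → xs ++ ys ↭ x ∷ zs →
  (∃ λ xs′ → xs ↭ x ∷ xs′ × xs′ ++ ys ↭ zs) ⊎ (∃ λ ys′ → ys ↭ x ∷ ys′ × xs ++ ys′ ↭ zs)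
++-uncons xs ys p with ∈-++⁻ xs (∈-resp-↭ (↭-sym p) (here ≡.refl))
... | inj₁ x∈xs = let xs′ , q = ∈⇒↭ x∈xs in
  inj₁ (xs′ , q , drop-∷ (↭-trans (++⁺ʳ ys (↭-sym q)) p))
... | inj₂ x∈ys = let ys′ , q = ∈⇒↭ x∈ys in
  inj₂ (ys′ , q , drop-∷ (↭-trans (↭-sym (↭-trans (++⁺ˡ xs q) (shift _ xs ys′))) p))

-- Parity and small arithmetic.

∨-true : ∀ {b c} → b ∨ c ≡ true → b ≡ true ⊎ c ≡ true
∨-true {true}  eq = inj₁ ≡.refl
∨-true {false} eq = inj₂ eq

isOdd-+ : ∀ a b → isOdd (a + b) ≡ isOdd a xor isOdd b
isOdd-+ zero    b = ≡.refl
isOdd-+ (suc a) b = ≡.trans (cong not (isOdd-+ a b)) (not-distribˡ-xor (isOdd a) (isOdd b))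

isOdd-double : ∀ a → isOdd (a + a) ≡ false
isOdd-double a = ≡.trans (isOdd-+ a a) (xor-same (isOdd a))

isOdd-ι : ∀ b → isOdd (ι b) ≡ b
isOdd-ι true  = ≡.refl
isOdd-ι false = ≡.refl

-- Modulo 2 every term may be replaced by its parity; this reduces the number of odd vertices to the
-- degree sum.
isOdd-∑ : (f : A → ℕ) (xs : List A) → isOdd (∑ (ι ∘ isOdd ∘ f) xs) ≡ isOdd (∑ f xs)
isOdd-∑ f []       = ≡.refl
isOdd-∑ f (x ∷ xs) = begin
  isOdd (ι (isOdd (f x)) + ∑ (ι ∘ isOdd ∘ f) xs)             ≡⟨ isOdd-+ (ι (isOdd (f x))) _ ⟩
  isOdd (ι (isOdd (f x))) xor isOdd (∑ (ι ∘ isOdd ∘ f) xs)   ≡⟨ cong₂ _xor_ (isOdd-ι (isOdd (f x))) (isOdd-∑ f xs) ⟩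
  isOdd (f x) xor isOdd (∑ f xs)                             ≡⟨ isOdd-+ (f x) _ ⟨
  isOdd (f x + ∑ f xs)                                       ∎
  where open ≡-Reasoning

-- Numbers that differ by exactly one have an odd sum. At a vertex of even degree this turns near
-- balance into equality.
even-sum⇒≡ : ∀ a b → a ≤ suc b → b ≤ suc a → isOdd (a + b) ≡ false → a ≡ b
even-sum⇒≡ zero          zero          _         _         _    = ≡.refl
even-sum⇒≡ zero          (suc zero)    _         _         ()
even-sum⇒≡ zero          (suc (suc b)) _         (s≤s ())  _
even-sum⇒≡ (suc zero)    zero          _         _         ()
even-sum⇒≡ (suc (suc a)) zero          (s≤s ())  _         _
even-sum⇒≡ (suc a)       (suc b)       (s≤s le)  (s≤s le′) even =
  cong suc (even-sum⇒≡ a b le le′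
    (≡.trans (≡.sym (not-involutive _)) (≡.trans (cong (not ∘ isOdd) (≡.sym (+-suc a b))) even)))

-- If `a` were at least 2, then `b` would be at least 1 and the sum at least 3.
a+b≤2⇒a≤1 : ∀ {a b} → a ≤ suc b → a + b ≤ 2 → a ≤ 1
a+b≤2⇒a≤1 {zero}        _ _ = z≤n
a+b≤2⇒a≤1 {suc zero}    _ _ = s≤s z≤n
a+b≤2⇒a≤1 {suc (suc a)} (s≤s (s≤s {n = b} a≤b)) (s≤s (s≤s le))
  rewrite +-suc a b with () ← le

halves≤ : ∀ t → ⌊ t /2⌋ + ⌊ t /2⌋ ≤ t
halves≤ t = subst (⌊ t /2⌋ + ⌊ t /2⌋ ≤_) (⌊n/2⌋+⌈n/2⌉≡n t) (+-monoʳ-≤ ⌊ t /2⌋ (⌊n/2⌋≤⌈n/2⌉ t))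

-- Pairing, splitting and pigeonhole arguments for lists.

length-filterᵇ : (p : A → Bool) (xs : List A) → length (filterᵇ p xs) ≡ countB p xs
length-filterᵇ p []       = ≡.refl
length-filterᵇ p (x ∷ xs) with p x
... | true  = cong suc (length-filterᵇ p xs)
... | false = length-filterᵇ p xs

pairUp : List A → List (A × A)
pairUp (x ∷ y ∷ xs) = (x , y) ∷ pairUp xs
pairUp _            = []

length-pairUp : (xs : List A) → isOdd (length xs) ≡ false → length xs ≡ length (pairUp xs) * 2
length-pairUp []           even = ≡.refl
length-pairUp (x ∷ [])     ()
length-pairUp (x ∷ y ∷ xs) even =
  cong (suc ∘ suc) (length-pairUp xs (≡.trans (≡.sym (not-involutive _)) even))

map-≡-++ : ∀ {f : A → B} (xs : List A) ys {zs} → map f xs ≡ ys ++ zs →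
  ∃₂ λ xs₁ xs₂ → xs ≡ xs₁ ++ xs₂ × ys ≡ map f xs₁ × zs ≡ map f xs₂
map-≡-++ xs       []       eq     = [] , xs , ≡.refl , ≡.refl , ≡.sym eq
map-≡-++ (x ∷ xs) (y ∷ ys) eq with ∷-injective eq
... | ≡.refl , eq′ with map-≡-++ xs ys eq′
... | xs₁ , xs₂ , ≡.refl , ≡.refl , ≡.refl = x ∷ xs₁ , xs₂ , ≡.refl , ≡.refl , ≡.refl

-- The pigeonhole principle, in the form that finds a colour class missing a given vertex.
∑<length⇒zero : (f : A → ℕ) (xs : List A) → ∑ f xs < length xs →
  ∃₂ λ x xs′ → xs ↭ x ∷ xs′ × f x ≡ 0
∑<length⇒zero f (x ∷ xs) lt with f x in fx
... | zero  = x , xs , ↭-refl , fx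
... | suc m with y , ys , p , fy ← ∑<length⇒zero f xs (≤-trans (s≤s (m≤n+m (∑ f xs) m)) (≤-pred lt))
            = y , x ∷ ys , ↭-trans (prep _ p) (swap _ _ ↭-refl) , fy

-- One entry with value 0 would leave a deficit that the others, at most 1 each, cannot make up.
saturated : (f : A → ℕ) {xs : List A} → All (λ x → f x ≤ 1) xs → ∑ f xs ≡ length xs →
  All (λ x → f x ≡ 1) xs
saturated f {[]}     []        eq = []
saturated f {x ∷ xs} (le ∷ les) eq with f x in fx | le
... | suc zero | s≤s z≤n = fx ∷ saturated f les (suc-injective eq)
... | zero     | _ = contradiction (subst (_≤ length xs) eq (∑≤length les)) (n≮n _)
  where
  ∑≤length : ∀ {ys} → All (λ y → f y ≤ 1) ys → ∑ f ys ≤ length ys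
  ∑≤length []         = z≤n
  ∑≤length (le ∷ les) = +-mono-≤ le (∑≤length les)

-- Multiplicities of list entries.

module Occurrences {V : Set} (_≟_ : DecidableEquality V) where

  δ : V → V → ℕ
  δ x y = ι (does (x ≟ y))

  δ-refl : ∀ x → δ x x ≡ 1
  δ-refl x with x ≟ x
  ... | yes _  = ≡.refl
  ... | no x≢x = contradiction ≡.refl x≢x

  δ-≢ : ∀ {x y} → x ≢ y → δ x y ≡ 0
  δ-≢ {x} {y} x≢y with x ≟ y
  ... | yes x≡y = contradiction x≡y x≢y
  ... | no _    = ≡.refl

  δ≤1 : ∀ x y → δ x y ≤ 1
  δ≤1 x y with x ≟ y
  ... | yes _ = s≤s z≤n
  ... | no _  = z≤n

  ∑-δ-∉ : ∀ {x} (f : V → ℕ) {xs} → x ∉ xs → ∑ (λ y → δ x y * f y) xs ≡ 0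
  ∑-δ-∉     f {[]}     x∉ = ≡.refl
  ∑-δ-∉ {x} f {y ∷ xs} x∉
    rewrite δ-≢ {x} {y} (x∉ ∘ here) = ∑-δ-∉ f (x∉ ∘ there)

  ∑-δ : ∀ {x} (f : V → ℕ) {xs} → Unique xs → x ∈ xs → ∑ (λ y → δ x y * f y) xs ≡ f x
  ∑-δ {x} f {_ ∷ xs} (x≢ ∷ _) (here ≡.refl)
    rewrite δ-refl x | ∑-δ-∉ {x} f {xs} (λ x∈ → All.lookup x≢ x∈ ≡.refl)
    = ≡.trans (+-identityʳ _) (+-identityʳ _)
  ∑-δ {x} f {y ∷ xs} (y≢ ∷ xs!) (there x∈)
    rewrite δ-≢ {x} {y} (λ x≡y → All.lookup y≢ x∈ (≡.sym x≡y)) = ∑-δ f xs! x∈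

  δ>0⇒∈ : ∀ {x} xs → 0 < ∑ (δ x) xs → x ∈ xs
  δ>0⇒∈ {x} (y ∷ xs) occ with x ≟ y
  ... | yes x≡y = here x≡y
  ... | no _    = there (δ>0⇒∈ xs occ)

  occurs : ∀ x xs → 0 < ∑ (δ x) (x ∷ xs)
  occurs x xs rewrite δ-refl x = s≤s z≤n

  -- The head of the first list has a positive count in the second; removing it from both keeps all
  -- counts equal. This turns degree conditions into rearrangements.
  occurrences-↭ : ∀ xs ys → (∀ x → ∑ (δ x) xs ≡ ∑ (δ x) ys) → xs ↭ ys
  occurrences-↭ []       []       eq = refl
  occurrences-↭ []       (y ∷ ys) eq with () ← subst (0 <_) (≡.sym (eq y)) (occurs y ys)
  occurrences-↭ (x ∷ xs) ys       eq
    with ys′ , ys↭ ← ∈⇒↭ (δ>0⇒∈ ys (subst (0 <_) (eq x) (occurs x xs)))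
    = ↭-trans (prep x (occurrences-↭ xs ys′ λ z →
                         +-cancelˡ-≡ (δ z x) _ _ (≡.trans (eq z) (∑-↭ (δ z) ys↭))))
              (↭-sym ys↭)

-- Balanced orientations of multigraphs.

module Digraph {V : Set} (_≟_ : DecidableEquality V) where
  open Occurrences _≟_

  Arc : Set
  Arc = V × V

  out in′ deg : V → List Arc → ℕ
  out x = ∑ λ a → δ x (proj₁ a)
  in′ x = ∑ λ a → δ x (proj₂ a)
  deg x = ∑ λ a → δ x (proj₁ a) + δ x (proj₂ a)

  deg≡out+in : ∀ x L → deg x L ≡ out x L + in′ x L
  deg≡out+in x = ∑-+ (λ a → δ x (proj₁ a)) (λ a → δ x (proj₂ a))

  -- The slack of one is what a vertex of odd degree requires.
  record Balanced (D : List Arc) : Set where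
    constructor mkBalanced
    field
      balancedAt : ∀ x → out x D ≤ suc (in′ x D) × in′ x D ≤ suc (out x D)
  open Balanced public

  Balanced-resp-↭ : ∀ {D D′} → D ↭ D′ → Balanced D → Balanced D′
  Balanced-resp-↭ p bal = mkBalanced λ x →
    subst₂ (λ o i → o ≤ suc i × i ≤ suc o) (∑-↭ _ p) (∑-↭ _ p) (balancedAt bal x)

  -- Subdividing gives `v` one more arc in and one more arc out and changes no other count.
  Balanced-subdivide : ∀ {u v w D} → Balanced ((u , w) ∷ D) → Balanced ((u , v) ∷ (v , w) ∷ D)
  Balanced-subdivide {u} {v} {w} {D} bal =
    mkBalanced λ x → Product.map (through x) (through′ x) (balancedAt bal x)
    where
    through : ∀ x → δ x u + out x D ≤ suc (δ x w + in′ x D) →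
              δ x u + (δ x v + out x D) ≤ suc (δ x v + (δ x w + in′ x D))
    through x le rewrite x∙yz≈y∙xz +-commutativeSemigroup (δ x u) (δ x v) (out x D)
                     | ≡.sym (+-suc (δ x v) (δ x w + in′ x D)) = +-monoʳ-≤ (δ x v) le
    through′ : ∀ x → δ x w + in′ x D ≤ suc (δ x u + out x D) →
               δ x v + (δ x w + in′ x D) ≤ suc (δ x u + (δ x v + out x D))
    through′ x le rewrite x∙yz≈y∙xz +-commutativeSemigroup (δ x u) (δ x v) (out x D)
                      | ≡.sym (+-suc (δ x v) (δ x u + out x D)) = +-monoʳ-≤ (δ x v) le

  -- An orientation keeps the arcs of forward and reverses those of backward.
  record BalancedOrientation (L : List Arc) : Set where
    field
      forward backward : List Arc
      arcs             : forward ++ backward ↭ L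
    oriented : List Arc
    oriented = forward ++ map Product.swap backward
    field
      balanced         : Balanced oriented
  open BalancedOrientation public

  deg-oriented : ∀ x F B → deg x (F ++ map Product.swap B) ≡ deg x (F ++ B)
  deg-oriented x F B = begin
    deg x (F ++ map Product.swap B)       ≡⟨ ∑-++ _ F _ ⟩
    deg x F + deg x (map Product.swap B)  ≡⟨ cong (deg x F +_) (∑-map _ Product.swap B) ⟩
    deg x F + _                           ≡⟨ cong (deg x F +_) (∑-cong (λ a → +-comm (δ x (proj₂ a)) _) B) ⟩
    deg x F + deg x B                     ≡⟨ ∑-++ _ F B ⟨
    deg x (F ++ B)                        ∎
    where open ≡-Reasoning

  orient-↭ : ∀ {L L′} → L ↭ L′ → BalancedOrientation L → BalancedOrientation L′
  orient-↭ p O = record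
    { forward = forward O ; backward = backward O ; arcs = ↭-trans (arcs O) p ; balanced = balanced O }

  -- Moving the edge between `forward` and `backward` compensates for its new reading direction, so
  -- the oriented arcs stay the same.
  orient-swap : ∀ {a L} → BalancedOrientation (a ∷ L) → BalancedOrientation (Product.swap a ∷ L)
  orient-swap {a} O with ++-uncons (forward O) (backward O) (arcs O)
  ... | inj₁ (F , F↭ , p) = record
    { forward  = F
    ; backward = Product.swap a ∷ backward O
    ; arcs     = ↭-trans (shift _ F _) (prep _ p)
    ; balanced = Balanced-resp-↭ (↭-trans (++⁺ʳ _ F↭) (↭-sym (shift a F _))) (balanced O)
    }
  ... | inj₂ (B , B↭ , p) = record
    { forward  = Product.swap a ∷ forward O
    ; backward = B
    ; arcs     = prep _ p
    ; balanced = Balanced-resp-↭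
        (↭-trans (++⁺ˡ (forward O) (map⁺ Product.swap B↭)) (shift _ (forward O) _)) (balanced O)
    }

  -- Both halves inherit the direction given to the edge from `u` to `w`.
  orient-subdivide : ∀ {u v w L} → BalancedOrientation ((u , w) ∷ L) →
    BalancedOrientation ((u , v) ∷ (v , w) ∷ L)
  orient-subdivide {u} {v} {w} O with ++-uncons (forward O) (backward O) (arcs O)
  ... | inj₁ (F , F↭ , p) = record
    { forward  = (u , v) ∷ (v , w) ∷ F
    ; backward = backward O
    ; arcs     = prep _ (prep _ p)
    ; balanced = Balanced-subdivide (Balanced-resp-↭ (++⁺ʳ _ F↭) (balanced O))
    }
  ... | inj₂ (B , B↭ , p) = record
    { forward  = forward O
    ; backward = (u , v) ∷ (v , w) ∷ B
    ; arcs     = ↭-trans (shifts (forward O) ((u , v) ∷ (v , w) ∷ [])) (prep _ (prep _ p))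
    ; balanced = Balanced-resp-↭
        (↭-trans (swap _ _ ↭-refl) (↭-sym (shifts (forward O) ((v , u) ∷ (w , v) ∷ []))))
        (Balanced-subdivide (Balanced-resp-↭
          (↭-trans (++⁺ˡ (forward O) (map⁺ Product.swap B↭)) (shift _ (forward O) _)) (balanced O)))
    }

  -- The new arc is the only one at its ends, so either direction keeps in- and out-degree there
  -- within one of each other.
  orient-isolated : ∀ {u v L} → deg u L ≡ 0 → deg v L ≡ 0 →
    BalancedOrientation L → BalancedOrientation ((u , v) ∷ L)
  orient-isolated {u} {v} {L} u∉ v∉ O = record
    { forward  = (u , v) ∷ forward O
    ; backward = backward O
    ; arcs     = prep _ (arcs O)
    ; balanced = mkBalanced bal
    }
    where
    D : List Arc
    D = oriented O
    absent : ∀ {x} → deg x L ≡ 0 → out x D + in′ x D ≡ 0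
    absent {x} x∉ = ≡.trans (≡.sym (deg≡out+in x D))
      (≡.trans (deg-oriented x (forward O) (backward O)) (≡.trans (∑-↭ _ (arcs O)) x∉))
    bounded : ∀ {x} → deg x L ≡ 0 →
      δ x u + out x D ≤ suc (δ x v + in′ x D) × δ x v + in′ x D ≤ suc (δ x u + out x D)
    bounded {x} x∉
      rewrite m+n≡0⇒m≡0 (out x D) (absent {x} x∉) | m+n≡0⇒n≡0 (out x D) (absent {x} x∉)
            | +-identityʳ (δ x u) | +-identityʳ (δ x v)
      = ≤-trans (δ≤1 x u) (s≤s z≤n) , ≤-trans (δ≤1 x v) (s≤s z≤n)
    bal : ∀ x → δ x u + out x D ≤ suc (δ x v + in′ x D) × δ x v + in′ x D ≤ suc (δ x u + out x D)
    bal x with x ≟ u | x ≟ v | bounded {x}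
    ... | yes ≡.refl | _          | b = b u∉
    ... | no _       | yes ≡.refl | b = b v∉
    ... | no _       | no _       | _ = balancedAt (balanced O) x

  incident? : ∀ v L → (∃₂ λ w L′ → L ↭ (v , w) ∷ L′ ⊎ L ↭ (w , v) ∷ L′) ⊎ deg v L ≡ 0
  incident? v []            = inj₂ ≡.refl
  incident? v ((x , y) ∷ L) with v ≟ x | v ≟ y | incident? v L
  ... | yes ≡.refl | _          | _                           = inj₁ (y , L , inj₁ ↭-refl)
  ... | no _       | yes ≡.refl | _                           = inj₁ (x , L , inj₂ ↭-refl)
  ... | no _       | no _       | inj₂ v∉                     = inj₂ v∉
  ... | no _       | no _       | inj₁ (w , L′ , inj₁ p) =
    inj₁ (w , _ , inj₁ (↭-trans (prep _ p) (swap _ _ ↭-refl)))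
  ... | no _       | no _       | inj₁ (w , L′ , inj₂ p) =
    inj₁ (w , _ , inj₂ (↭-trans (prep _ p) (swap _ _ ↭-refl)))

  -- Two edges uv, vw are replaced by uw; an orientation of uw is then subdivided again.
  balancedOrientation : ∀ L → BalancedOrientation L
  balancedOrientation L = orient (length L) L ≤-refl
    where
    orient : ∀ m L → length L ≤ m → BalancedOrientation L

    join : ∀ {u v L w L′} m → length L ≤ m → L ↭ (v , w) ∷ L′ ⊎ L ↭ (w , v) ∷ L′ →
      BalancedOrientation ((u , v) ∷ L)
    join {u} {w = w} {L′} m le (inj₁ p) =
      orient-↭ (prep _ (↭-sym p)) (orient-subdivide
        (orient m ((u , w) ∷ L′) (subst (_≤ m) (↭-length p) le)))
    -- The second edge is listed as `(w , v)`, so its half is reversed after the subdivision.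
    join {u} {w = w} {L′} m le (inj₂ p) =
      orient-↭ (↭-trans (swap _ _ ↭-refl) (prep _ (↭-sym p))) (orient-swap
        (orient-↭ (swap _ _ ↭-refl) (orient-subdivide
          (orient m ((u , w) ∷ L′) (subst (_≤ m) (↭-length p) le)))))

    orient m       []            le       =
      record { forward = [] ; backward = [] ; arcs = refl ; balanced = mkBalanced λ x → z≤n , z≤n }
    -- `m` bounds the number of edges, which drops by one when two edges are merged.
    orient (suc m) ((u , v) ∷ L) (s≤s le) with incident? v L | incident? u L
    ... | inj₁ (_ , _ , p) | _                = join m le p
    ... | inj₂ _           | inj₁ (_ , _ , p) = orient-swap (join m le p)
    ... | inj₂ v∉          | inj₂ u∉          = orient-isolated u∉ v∉ (orient m L le)

-- König's edge colouring theorem.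

module Bipartite {V : Set} (_≟_ : DecidableEquality V) where
  open Occurrences _≟_
  open Digraph _≟_
  private module Sides = Digraph (≡-dec _≟_ _≟_)

  -- Out- and in-degree of `x` are the degrees of its two copies in the bipartite graph, so
  -- `Bounded 1` describes a matching.
  Bounded : ℕ → List Arc → Set
  Bounded k L = ∀ x → out x L ≤ k × in′ x L ≤ k

  -- Tagging sources and targets apart makes the graph bipartite; even a loop then joins two
  -- different vertices.
  across : Arc → (V ⊎ V) × (V ⊎ V)
  across (u , v) = inj₁ u , inj₂ v

  -- Here `A` runs from the left side to the right and `B` runs back. Hence at a left vertex the
  -- out-degree counts `A` and the in-degree counts `B`; at a right vertex the roles are exchanged.
  out-across : ∀ x A B →
    Sides.out (inj₁ x) (map across A ++ map Product.swap (map across B)) ≡ out x A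
  out-across x []      []      = ≡.refl
  out-across x []      (_ ∷ B) = out-across x [] B
  out-across x (a ∷ A) B       = cong (δ x (proj₁ a) +_) (out-across x A B)

  in-across : ∀ x A B →
    Sides.in′ (inj₁ x) (map across A ++ map Product.swap (map across B)) ≡ out x B
  in-across x []      []      = ≡.refl
  in-across x []      (b ∷ B) = cong (δ x (proj₁ b) +_) (in-across x [] B)
  in-across x (_ ∷ A) B       = in-across x A B

  out-across′ : ∀ x A B →
    Sides.out (inj₂ x) (map across A ++ map Product.swap (map across B)) ≡ in′ x B
  out-across′ x []      []      = ≡.refl
  out-across′ x []      (b ∷ B) = cong (δ x (proj₂ b) +_) (out-across′ x [] B)
  out-across′ x (_ ∷ A) B       = out-across′ x A B

  in-across′ : ∀ x A B →
    Sides.in′ (inj₂ x) (map across A ++ map Product.swap (map across B)) ≡ in′ x A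
  in-across′ x []      []      = ≡.refl
  in-across′ x []      (_ ∷ B) = in-across′ x [] B
  in-across′ x (a ∷ A) B       = cong (δ x (proj₂ a) +_) (in-across′ x A B)

  -- Orient the bipartite graph evenly and colour each arc by the side at which it starts.
  twoMatchings : ∀ L → Bounded 2 L → ∃₂ λ A B → A ++ B ↭ L × Bounded 1 A × Bounded 1 B
  twoMatchings L b
    with O ← Sides.balancedOrientation (map across L)
    -- The orientation partitions a rearrangement of `map across L`, so its two parts are the images
    -- of two pieces of a rearrangement `L′` of `L`.
    with L′ , eq , L↭L′ ← ↭-map-inv across (↭-sym (Sides.arcs O))
    with A , B , ≡.refl , F≡ , B≡ ← map-≡-++ L′ (Sides.forward O) (≡.sym eq)
    = A , B , ↭-sym L↭L′ , (λ x → proj₁ (left x) , proj₁ (right x))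
                         , (λ x → proj₂ (left x) , proj₂ (right x))
    where
    bal : Sides.Balanced (map across A ++ map Product.swap (map across B))
    bal = subst₂ (λ F B → Sides.Balanced (F ++ map Product.swap B)) F≡ B≡ (Sides.balanced O)
    atMost1 : ∀ {a b} → a ≤ suc b × b ≤ suc a → a + b ≤ 2 → a ≤ 1 × b ≤ 1
    atMost1 {a} {b} (le , le′) a+b≤2 =
      a+b≤2⇒a≤1 le a+b≤2 , a+b≤2⇒a≤1 le′ (subst (_≤ 2) (+-comm a b) a+b≤2)
    left : ∀ x → out x A ≤ 1 × out x B ≤ 1
    left x = atMost1
      (subst₂ (λ o i → o ≤ suc i × i ≤ suc o) (out-across x A B) (in-across x A B)
        (Sides.balancedAt bal (inj₁ x)))
      (subst (_≤ 2) (≡.trans (∑-↭ _ L↭L′) (∑-++ _ A B)) (proj₁ (b x)))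
    right : ∀ x → in′ x A ≤ 1 × in′ x B ≤ 1
    right x = Product.swap (atMost1
      (subst₂ (λ o i → o ≤ suc i × i ≤ suc o) (out-across′ x A B) (in-across′ x A B)
        (Sides.balancedAt bal (inj₂ x)))
      (subst (_≤ 2) (≡.trans (≡.trans (∑-↭ _ L↭L′) (∑-++ _ A B)) (+-comm (in′ x A) _)) (proj₂ (b x))))

  record Colouring (k : ℕ) (L : List Arc) : Set where
    field
      classes   : List (List Arc)
      number    : length classes ≡ k
      partition : concat classes ↭ L
      matchings : All (Bounded 1) classes
  open Colouring public

  emptyColouring : ∀ k → Colouring k []
  emptyColouring zero    =
    record { classes = [] ; number = ≡.refl ; partition = refl ; matchings = [] }
  emptyColouring (suc k) = let Γ = emptyColouring k in record
    { classes   = [] ∷ classes Γ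
    ; number    = cong suc (number Γ)
    ; partition = partition Γ
    ; matchings = (λ x → z≤n , z≤n) ∷ matchings Γ
    }

  -- A class C with no arc out of u and a class C′ with no arc into v are merged with uv and
  -- split anew into two matchings.
  addArc : ∀ {k L} a → Bounded k (a ∷ L) → Colouring k L → Colouring k (a ∷ L)
  addArc {k} {L} a@(u , v) b Γ = insert
    where
    free< : ∀ (f : List Arc → ℕ) → (f (concat (classes Γ)) ≡ ∑ f (classes Γ)) →
            (∀ {L L′} → L ↭ L′ → f L ≡ f L′) → suc (f L) ≤ k → ∑ f (classes Γ) < length (classes Γ)
    free< f add resp le = subst₂ _<_ (≡.trans (≡.sym (resp (partition Γ))) add) (≡.sym (number Γ)) le

    -- The arc `a` is itself one of the at most `k` arcs out of `u`, so fewer than `k` remain for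
    -- the `k` classes.
    u-free : ∑ (out u) (classes Γ) < length (classes Γ)
    u-free = free< (out u) (∑-concat _ (classes Γ)) (∑-↭ _)
      (subst (λ d → d + out u L ≤ k) (δ-refl u) (proj₁ (b u)))

    v-free : ∑ (in′ v) (classes Γ) < length (classes Γ)
    v-free = free< (in′ v) (∑-concat _ (classes Γ)) (∑-↭ _)
      (subst (λ d → d + in′ v L ≤ k) (δ-refl v) (proj₂ (b v)))

    δ+≤ : ∀ {x y} m {n} → (x ≡ y → m ≡ 0) → m ≤ n → 1 ≤ n → δ x y + m ≤ n
    δ+≤ {x} {y} m m≡0 m≤n 1≤n with x ≟ y
    ... | yes x≡y rewrite m≡0 x≡y = 1≤n
    ... | no _    = m≤n

    insert : Colouring k (a ∷ L)
    insert with ∑<length⇒zero (out u) (classes Γ) u-free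
    ... | C , Cs , p , u∉C with in′ v C in v∈C
    -- `C` has no arc into `v` either, so it absorbs `a` directly.
    ... | zero  = record
      { classes   = (a ∷ C) ∷ Cs
      ; number    = ≡.trans (≡.sym (↭-length p)) (number Γ)
      ; partition = prep a (↭-trans (↭-sym (concat-↭ p)) (partition Γ))
      ; matchings = (λ x → δ+≤ (out x C) (λ { ≡.refl → u∉C }) (proj₁ (C≤1 x)) ≤-refl
                         , δ+≤ (in′ x C) (λ { ≡.refl → v∈C }) (proj₂ (C≤1 x)) ≤-refl) ∷ Cs≤1
      }
      where
      C≤1 : Bounded 1 C
      C≤1 = All.head (All-resp-↭ p (matchings Γ))
      Cs≤1 : All (Bounded 1) Cs
      Cs≤1 = All.tail (All-resp-↭ p (matchings Γ))
    -- `C` already uses up an arc into `v`, so among the other classes there are still fewer such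
    -- arcs than classes.
    ... | suc m with ∑<length⇒zero (in′ v) Cs
                       (≤-trans (s≤s (m≤n+m _ m)) (≤-pred (subst₂ _<_
                         (≡.trans (∑-↭ (in′ v) p) (cong (_+ ∑ (in′ v) Cs) v∈C)) (↭-length p) v-free)))
    ...   | C′ , Cs′ , p′ , v∉C′ = record
      { classes   = proj₁ AB ∷ proj₁ (proj₂ AB) ∷ Cs′
      ; number    = ≡.trans (≡.sym (↭-length q)) (number Γ)
      ; partition = begin
          proj₁ AB ++ proj₁ (proj₂ AB) ++ concat Cs′    ≡⟨ ++-assoc (proj₁ AB) _ _ ⟨
          (proj₁ AB ++ proj₁ (proj₂ AB)) ++ concat Cs′  ↭⟨ ++⁺ʳ _ (proj₁ (proj₂ (proj₂ AB))) ⟩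
          a ∷ (C ++ C′) ++ concat Cs′                   ≡⟨ cong (a ∷_) (++-assoc C _ _) ⟩
          a ∷ concat (C ∷ C′ ∷ Cs′)                     ↭⟨ prep a (concat-↭ q) ⟨
          a ∷ concat (classes Γ)                        ↭⟨ prep a (partition Γ) ⟩
          a ∷ L                                         ∎
      ; matchings = proj₁ (proj₂ (proj₂ (proj₂ AB))) ∷ proj₂ (proj₂ (proj₂ (proj₂ AB)))
                    ∷ All.tail (All.tail Γ≤1)
      }
      where
      open PermutationReasoning
      q : classes Γ ↭ C ∷ C′ ∷ Cs′
      q = ↭-trans p (prep C p′)
      Γ≤1 : All (Bounded 1) (C ∷ C′ ∷ Cs′)
      Γ≤1 = All-resp-↭ q (matchings Γ)
      -- For out-degrees `a` is charged to `C`, which has no arc out of `u`; for in-degrees it is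
      -- charged to `C′`, which has none into `v`.
      bounded : ∀ x → (out x C ≤ 1 × in′ x C ≤ 1) → (out x C′ ≤ 1 × in′ x C′ ≤ 1) →
        out x (a ∷ C ++ C′) ≤ 2 × in′ x (a ∷ C ++ C′) ≤ 2
      bounded x (o , i) (o′ , i′)
        rewrite ∑-++ (λ a → δ x (proj₁ a)) C C′ | ∑-++ (λ a → δ x (proj₂ a)) C C′
              | ≡.sym (+-assoc (δ x u) (out x C) (out x C′))
              | x∙yz≈y∙xz +-commutativeSemigroup (δ x v) (in′ x C) (in′ x C′)
        = +-mono-≤ (δ+≤ (out x C) (λ { ≡.refl → u∉C }) o ≤-refl) o′
        , +-mono-≤ i (δ+≤ (in′ x C′) (λ { ≡.refl → v∉C′ }) i′ ≤-refl)
      AB = twoMatchings (a ∷ C ++ C′)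
             (λ x → bounded x (All.head Γ≤1 x) (All.head (All.tail Γ≤1) x))

  colouring : ∀ k L → Bounded k L → Colouring k L
  colouring k []      b = emptyColouring k
  colouring k (a ∷ L) b = addArc a b (colouring k L λ x →
    ≤-trans (m≤n+m _ _) (proj₁ (b x)) , ≤-trans (m≤n+m _ _) (proj₂ (b x)))

-- Edge sets modulo 2 and paths.

module PathCovers (n : ℕ) where
  open Digraph {Fin n} Fin._≟_

  -- The test that `hasEdge` applies to a single step, in the same Boolean form so that the two
  -- unfold to each other.
  joins : Fin n → Fin n → Arc → Bool
  joins u v (x , y) = (⌊ x Fin.≟ u ⌋ ∧ ⌊ y Fin.≟ v ⌋) ∨ (⌊ x Fin.≟ v ⌋ ∧ ⌊ y Fin.≟ u ⌋)

  mult : Fin n → Fin n → List Arc → ℕ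
  mult u v = ∑ (ι ∘ joins u v)

  -- Equality of the underlying edge sets modulo 2; loops and directions are ignored.
  record _≈₂_ (L L′ : List Arc) : Set where
    constructor mk≈₂
    field
      parity : ∀ u v → u ≢ v → isOdd (mult u v L) ≡ isOdd (mult u v L′)
  open _≈₂_ public

  isOdd-++ : ∀ u v L L′ → isOdd (mult u v (L ++ L′)) ≡ isOdd (mult u v L) xor isOdd (mult u v L′)
  isOdd-++ u v L L′ = ≡.trans (cong isOdd (∑-++ _ L L′)) (isOdd-+ (mult u v L) _)

  ≈₂-refl : ∀ {L} → L ≈₂ L
  ≈₂-refl = mk≈₂ λ u v u≢v → ≡.refl

  ≈₂-sym : ∀ {L L′} → L ≈₂ L′ → L′ ≈₂ L
  ≈₂-sym p = mk≈₂ λ u v u≢v → ≡.sym (parity p u v u≢v)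

  ≈₂-trans : ∀ {L L′ L″} → L ≈₂ L′ → L′ ≈₂ L″ → L ≈₂ L″
  ≈₂-trans p q = mk≈₂ λ u v u≢v → ≡.trans (parity p u v u≢v) (parity q u v u≢v)

  ≈₂-setoid : Setoid _ _
  ≈₂-setoid = record
    { _≈_           = _≈₂_
    ; isEquivalence = record { refl = ≈₂-refl ; sym = ≈₂-sym ; trans = ≈₂-trans }
    }

  ↭⇒≈₂ : ∀ {L L′} → L ↭ L′ → L ≈₂ L′
  ↭⇒≈₂ p = mk≈₂ λ u v u≢v → cong isOdd (∑-↭ _ p)

  ≈₂-++ : ∀ {L₁ L₁′ L₂ L₂′} → L₁ ≈₂ L₁′ → L₂ ≈₂ L₂′ → (L₁ ++ L₂) ≈₂ (L₁′ ++ L₂′)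
  ≈₂-++ {L₁} {L₁′} p q = mk≈₂ λ u v u≢v → ≡.trans (isOdd-++ u v L₁ _)
    (≡.trans (cong₂ _xor_ (parity p u v u≢v) (parity q u v u≢v)) (≡.sym (isOdd-++ u v L₁′ _)))

  ≈₂-∷ : ∀ {a L L′} → L ≈₂ L′ → (a ∷ L) ≈₂ (a ∷ L′)
  ≈₂-∷ {a} = ≈₂-++ (≈₂-refl {a ∷ []})

  ++-self : ∀ L → (L ++ L) ≈₂ []
  ++-self L = mk≈₂ λ u v u≢v → ≡.trans (isOdd-++ u v L L) (xor-same (isOdd (mult u v L)))

  drop-double : ∀ {a L} → (a ∷ a ∷ L) ≈₂ L
  drop-double {a} {L} = ≈₂-++ (++-self (a ∷ [])) (≈₂-refl {L})

  joins-swap : ∀ u v a → joins u v (Product.swap a) ≡ joins u v a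
  joins-swap u v (x , y) = ≡.trans (∨-comm (⌊ y Fin.≟ u ⌋ ∧ ⌊ x Fin.≟ v ⌋) _)
    (cong₂ _∨_ (∧-comm ⌊ y Fin.≟ v ⌋ _) (∧-comm ⌊ y Fin.≟ u ⌋ _))

  ≈₂-swap : ∀ a {L} → (Product.swap a ∷ L) ≈₂ (a ∷ L)
  ≈₂-swap a {L} = mk≈₂ λ u v u≢v → cong (λ b → isOdd (ι b + mult u v L)) (joins-swap u v a)

  ≈₂-reverse : ∀ L → map Product.swap L ≈₂ L
  ≈₂-reverse []      = ≈₂-refl
  ≈₂-reverse (a ∷ L) = ≈₂-trans (≈₂-swap a) (≈₂-∷ (≈₂-reverse L))

  -- A loop at `x` could join `u` and `v` only if both were `x`.
  joins-loop : ∀ {u v} x → u ≢ v → joins u v (x , x) ≡ false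
  joins-loop {u} {v} x u≢v with x Fin.≟ u | x Fin.≟ v
  ... | yes ≡.refl | yes ≡.refl = contradiction ≡.refl u≢v
  ... | yes _      | no _       = ≡.refl
  ... | no _       | yes _      = ≡.refl
  ... | no _       | no _       = ≡.refl

  ≈₂-loop : ∀ {x L} → ((x , x) ∷ L) ≈₂ L
  ≈₂-loop {x} {L} = mk≈₂ λ u v u≢v → cong (λ b → isOdd (ι b + mult u v L)) (joins-loop x u≢v)

  steps : List (Fin n) → List Arc
  steps []           = []
  steps (x ∷ [])     = []
  steps (x ∷ y ∷ xs) = (x , y) ∷ steps (y ∷ xs)

  pathArcs : List (Path n) → List Arc
  pathArcs = concatMap (steps ∘ verts)

  joins⇒≡ : ∀ {u v : Fin n} x y → joins u v (x , y) ≡ true → (u ≡ x × v ≡ y) ⊎ (u ≡ y × v ≡ x)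
  joins⇒≡ {u} {v} x y eq with x Fin.≟ u | y Fin.≟ v | x Fin.≟ v | y Fin.≟ u
  ... | yes ≡.refl | yes ≡.refl | _          | _          = inj₁ (≡.refl , ≡.refl)
  ... | _          | _          | yes ≡.refl | yes ≡.refl = inj₂ (≡.refl , ≡.refl)
  joins⇒≡ x y () | yes _ | no _ | yes _ | no _
  joins⇒≡ x y () | yes _ | no _ | no _  | _
  joins⇒≡ x y () | no _  | _    | yes _ | no _
  joins⇒≡ x y () | no _  | _    | no _  | _

  hasEdge⇒∈ : ∀ {u v : Fin n} xs → hasEdge u v xs ≡ true → u ∈ xs × v ∈ xs
  hasEdge⇒∈ {u} {v} (x ∷ y ∷ xs) eq =
    [ first ∘ joins⇒≡ x y , Product.map there there ∘ hasEdge⇒∈ (y ∷ xs) ]′ (∨-true eq)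
    where
    first : (u ≡ x × v ≡ y) ⊎ (u ≡ y × v ≡ x) → u ∈ x ∷ y ∷ xs × v ∈ x ∷ y ∷ xs
    first (inj₁ (≡.refl , ≡.refl)) = here ≡.refl , there (here ≡.refl)
    first (inj₂ (≡.refl , ≡.refl)) = there (here ≡.refl) , here ≡.refl

  -- With distinct vertices no pair is consecutive twice, so the disjunction in `hasEdge` agrees
  -- with a sum.
  hasEdge-mult : ∀ u v {xs} → Unique xs → ι (hasEdge u v xs) ≡ mult u v (steps xs)
  hasEdge-mult u v {[]}         _          = ≡.refl
  hasEdge-mult u v {x ∷ []}     _          = ≡.refl
  hasEdge-mult u v {x ∷ y ∷ xs} (x≢ ∷ xs!) =
    ≡.trans (ι-∨ fresh) (cong (ι (joins u v (x , y)) +_) (hasEdge-mult u v xs!))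
    where
    ι-∨ : ∀ {b c} → (b ≡ true → c ≡ false) → ι (b ∨ c) ≡ ι b + ι c
    ι-∨ {false} _ = ≡.refl
    ι-∨ {true}  f rewrite f ≡.refl = ≡.refl
    -- A second use of the same pair would make `x` reappear later in the path.
    fresh : joins u v (x , y) ≡ true → hasEdge u v (y ∷ xs) ≡ false
    fresh eq with hasEdge u v (y ∷ xs) in e | joins⇒≡ x y eq
    ... | false | _ = ≡.refl
    ... | true  | inj₁ (≡.refl , _) = contradiction ≡.refl (All.lookup x≢ (proj₁ (hasEdge⇒∈ (y ∷ xs) e)))
    ... | true  | inj₂ (_ , ≡.refl) = contradiction ≡.refl (All.lookup x≢ (proj₂ (hasEdge⇒∈ (y ∷ xs) e)))

  countB-hasEdge : ∀ u v ps → countB (λ P → hasEdge u v (verts P)) ps ≡ mult u v (pathArcs ps)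
  countB-hasEdge u v ps = begin
    countB (λ P → hasEdge u v (verts P)) ps  ≡⟨ countB-∑ _ ps ⟩
    ∑ (λ P → ι (hasEdge u v (verts P))) ps   ≡⟨ ∑-cong (λ P → hasEdge-mult u v (distinct P)) ps ⟩
    ∑ (λ P → mult u v (steps (verts P))) ps  ≡⟨ ∑-concatMap _ (steps ∘ verts) ps ⟨
    mult u v (pathArcs ps)                   ∎
    where open ≡-Reasoning

  -- A loop is sent to the empty path: both contribute nothing modulo 2.
  edgePath : Arc → Path n
  edgePath (x , y) with x Fin.≟ y
  ... | yes _  = record { verts = [] ; distinct = [] }
  ... | no x≢y = record { verts = x ∷ y ∷ [] ; distinct = (x≢y ∷ []) ∷ [] ∷ [] }

  pathArcs-edgePath : ∀ L → pathArcs (map edgePath L) ≈₂ L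
  pathArcs-edgePath []            = ≈₂-refl
  pathArcs-edgePath ((x , y) ∷ L) with x Fin.≟ y
  ... | yes ≡.refl = ≈₂-trans (pathArcs-edgePath L) (≈₂-sym ≈₂-loop)
  ... | no _       = ≈₂-∷ (pathArcs-edgePath L)

  -- Writing a permutation as a sum of two paths modulo 2.

  sources targets : List Arc → List (Fin n)
  sources = map proj₁
  targets = map proj₂

  -- The arcs of a permutation of a finite set of vertices.
  record CycleSystem (L : List Arc) : Set where
    constructor cycleSystem
    field
      targets!        : Unique (targets L)
      sources↭targets : sources L ↭ targets L

  -- A path from x to b together with disjoint cycles.
  record PathSystem (x b : Fin n) (L : List Arc) : Set where
    constructor pathSystem
    field
      targets!        : Unique (x ∷ targets L)
      sources↭targets : b ∷ sources L ↭ x ∷ targets L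

  -- In the construction `Q` follows the opened cycle from `x` to `b` while `R` waits at `b`; from
  -- there both jump to the next cycle, and the two jumps cancel. The inclusions ensure that
  -- vertices passed earlier are not met again.
  record TwoPathsFrom (x b : Fin n) (L : List Arc) : Set where
    constructor twoPathsFrom
    field
      Q R : List (Fin n)
      Q!  : Unique (x ∷ Q)
      R!  : Unique (b ∷ R)
      Q⊆  : Q ⊆ targets L
      R⊆  : R ⊆ targets L
      covers : (steps (x ∷ Q) ++ steps (b ∷ R)) ≈₂ L

  -- The two paths start at the same vertex, so that a common vertex can be prepended to both.
  record TwoPaths (L : List Arc) : Set where
    constructor twoPaths
    field
      Q R : List (Fin n)
      Q!  : Unique Q
      R!  : Unique R
      Q⊆  : Q ⊆ targets L
      R⊆  : R ⊆ targets L
      covers  : (steps Q ++ steps R) ≈₂ L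
      covers′ : ∀ x → (steps (x ∷ Q) ++ steps (x ∷ R)) ≈₂ L

  Unique-resp-↭ : ∀ {xs ys : List (Fin n)} → xs ↭ ys → Unique xs → Unique ys
  Unique-resp-↭ p = PermutationSetoid.Unique-resp-↭ (≡.setoid (Fin n)) (↭⇒↭ₛ p)

  fresh : ∀ {x : Fin n} {xs Q} → Unique (x ∷ xs) → Q ⊆ xs → All (x ≢_) Q
  fresh (x≢ ∷ _) Q⊆ = All.tabulate (All.lookup x≢ ∘ Q⊆)

  CycleSystem-tail : ∀ {b a L} → CycleSystem ((b , a) ∷ L) → PathSystem a b L
  CycleSystem-tail (cycleSystem t! p) = pathSystem t! p

  -- The arc `(b , a)` is restored as the first step, reversed, of the second path; at a fixed point
  -- it is a loop and costs nothing. Both paths then start at `a`, so prepending `x` adds the same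
  -- step twice.
  close : ∀ {a b L} → PathSystem a b L → TwoPathsFrom a b L → TwoPaths ((b , a) ∷ L)
  close {a} {b} {L} S (twoPathsFrom Q R Q! R! Q⊆ R⊆ cov) with a Fin.≟ b
  ... | yes ≡.refl = twoPaths (a ∷ Q) (a ∷ R) Q! R! (∷⁺ʳ a Q⊆) (∷⁺ʳ a R⊆) covers (λ x →
    ≈₂-trans (↭⇒≈₂ (prep _ (shift _ (steps (a ∷ Q)) _))) (≈₂-trans drop-double covers))
    where
    covers : (steps (a ∷ Q) ++ steps (a ∷ R)) ≈₂ ((a , a) ∷ L)
    covers = ≈₂-trans cov (≈₂-sym ≈₂-loop)
  ... | no a≢b = twoPaths (a ∷ Q) (a ∷ b ∷ R) Q!
    ((a≢b ∷ fresh (PathSystem.targets! S) R⊆) ∷ R!)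
    (∷⁺ʳ a Q⊆) (∈-∷⁺ʳ (here ≡.refl) (∈-∷⁺ʳ b∈ (there ∘ R⊆))) covers (λ x →
    ≈₂-trans (↭⇒≈₂ (prep _ (shift _ (steps (a ∷ Q)) _))) (≈₂-trans drop-double covers))
    where
    b∈ : b ∈ a ∷ targets L
    b∈ = ∈-resp-↭ (PathSystem.sources↭targets S) (here ≡.refl)
    covers : (steps (a ∷ Q) ++ steps (a ∷ b ∷ R)) ≈₂ ((b , a) ∷ L)
    covers = ≈₂-trans (↭⇒≈₂ (shift _ (steps (a ∷ Q)) _)) (≈₂-trans (≈₂-∷ cov) (≈₂-swap (b , a)))

  extract-source : ∀ {x} L → x ∈ sources L → ∃₂ λ y L′ → L ↭ (x , y) ∷ L′
  extract-source L x∈ with ∈-map⁻ proj₁ x∈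
  ... | (x , y) , a∈ , ≡.refl = y , ∈⇒↭ a∈

  -- Mutual recursion: a cycle system is opened at its first arc, and a path system is followed from
  -- `x` until `b` is reached, where a smaller cycle system remains.
  twoPathsOf     : ∀ m L → length L ≤ m → CycleSystem L → TwoPaths L
  twoPathsFromTo : ∀ m {x b} L → length L ≤ m → PathSystem x b L → TwoPathsFrom x b L

  twoPathsOf m [] _ _ =
    twoPaths [] [] [] [] (λ ()) (λ ()) ≈₂-refl (λ _ → ≈₂-refl)
  twoPathsOf (suc m) ((b , a) ∷ L) (s≤s le) S =
    close (CycleSystem-tail S) (twoPathsFromTo m L le (CycleSystem-tail S))

  twoPathsFromTo m {x} {b} L le (pathSystem t! p) with x Fin.≟ b
  -- Both paths now stand at `b`, and the remaining arcs form a cycle system that misses it.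
  ... | yes ≡.refl with twoPaths Q R Q! R! Q⊆ R⊆ _ cov ← twoPathsOf m L le (cycleSystem (tail t!) (drop-∷ p))
    = twoPathsFrom Q R (fresh t! Q⊆ ∷ Q!) (fresh t! R⊆ ∷ R!) Q⊆ R⊆ (cov x)
  twoPathsFromTo m {x} {b} L le (pathSystem t! p) | no x≢b
    -- As `x` is not the final vertex `b`, it is the source of some arc.
    with ∈-resp-↭ (↭-sym p) (here ≡.refl)
  ... | here x≡b = contradiction x≡b x≢b
  ... | there x∈ with extract-source L x∈
  twoPathsFromTo zero    L le (pathSystem t! p) | no _ | there x∈ | y , L′ , L↭
    with () ← subst (_≤ 0) (↭-length L↭) le
  twoPathsFromTo (suc m) {x} {b} L le (pathSystem t! p) | no x≢b | there x∈ | y , L′ , L↭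
    with twoPathsFrom Q R Q! R! Q⊆ R⊆ cov ←
           twoPathsFromTo m {y} {b} L′ (≤-pred (subst (_≤ suc m) (↭-length L↭) le))
             (pathSystem (Unique-resp-↭ (map⁺ proj₂ L↭) (tail t!))
               -- Advancing from `x` to `y` removes `x` from both sides of the rearrangement.
               (drop-∷ (↭-trans (swap _ _ ↭-refl) (↭-trans (↭-trans (prep b (↭-sym (map⁺ proj₁ L↭))) p)
                 (prep x (map⁺ proj₂ L↭))))))
    = twoPathsFrom (y ∷ Q) R (fresh t! y∷Q⊆ ∷ Q!) R! y∷Q⊆ (within ∘ there ∘ R⊆)
        (≈₂-trans (≈₂-∷ cov) (↭⇒≈₂ (↭-sym L↭)))
    where
    within : y ∷ targets L′ ⊆ targets L
    within = ∈-resp-↭ (↭-sym (map⁺ proj₂ L↭))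
    y∷Q⊆ : y ∷ Q ⊆ targets L
    y∷Q⊆ = within ∘ ∷⁺ʳ y Q⊆

-- Splitting regular digraphs into permutations.

module Factorisations (n : ℕ) where
  open Occurrences {Fin n} Fin._≟_
  open Digraph {Fin n} Fin._≟_
  open Bipartite {Fin n} Fin._≟_
  open PathCovers n

  vertices! : Unique (allFin n)
  vertices! = allFin⁺ n

  occursOnce : ∀ {xs} → (∀ x → ∑ (δ x) xs ≡ 1) → xs ↭ allFin n
  occursOnce {xs} once = occurrences-↭ xs (allFin n) λ x → ≡.trans (once x) (≡.sym (once′ x))
    where
    once′ : ∀ x → ∑ (δ x) (allFin n) ≡ 1
    once′ x = ≡.trans (∑-cong (λ y → ≡.sym (*-identityʳ (δ x y))) (allFin n))
                      (∑-δ (λ _ → 1) vertices! (∈-allFin x))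

  -- Each vertex is a source once and a target once, so both lists rearrange the list of all
  -- vertices.
  cycleSystemOf : ∀ {L} → (∀ x → out x L ≡ 1) → (∀ x → in′ x L ≡ 1) → CycleSystem L
  cycleSystemOf {L} o i = cycleSystem (Unique-resp-↭ (↭-sym targets↭) vertices!)
                                      (↭-trans sources↭ (↭-sym targets↭))
    where
    sources↭ : sources L ↭ allFin n
    sources↭ = occursOnce λ x → ≡.trans (∑-map (δ x) proj₁ L) (o x)
    targets↭ : targets L ↭ allFin n
    targets↭ = occursOnce λ x → ≡.trans (∑-map (δ x) proj₂ L) (i x)

  Factorisation : ℕ → List Arc → Set
  Factorisation k L = Σ (List (List Arc)) λ cs → length cs ≡ k × concat cs ↭ L × All CycleSystem cs

  -- Each of the `k` matchings leaves a vertex at most once, but `k` arcs leave it in total; so each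
  -- matching leaves it exactly once, and likewise for entering.
  factorisation : ∀ k L → (∀ x → out x L ≡ k) → (∀ x → in′ x L ≡ k) → Factorisation k L
  factorisation k L o i = classes Γ , number Γ , partition Γ , All.tabulate λ C∈ →
    cycleSystemOf (λ x → All.lookup (saturated (out x) (All.map (λ b → proj₁ (b x)) (matchings Γ))
                           (≡.trans (total x proj₁) (≡.trans (o x) (≡.sym (number Γ))))) C∈)
                  (λ x → All.lookup (saturated (in′ x) (All.map (λ b → proj₂ (b x)) (matchings Γ))
                           (≡.trans (total x proj₂) (≡.trans (i x) (≡.sym (number Γ))))) C∈)
    where
    Γ : Colouring k L
    Γ = colouring k L λ x → ≤-reflexive (o x) , ≤-reflexive (i x)
    total : ∀ x (end : Arc → Fin n) →
      ∑ (∑ (δ x ∘ end)) (classes Γ) ≡ ∑ (δ x ∘ end) L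
    total x end = ≡.trans (≡.sym (∑-concat _ (classes Γ))) (∑-↭ _ (partition Γ))

  -- A loop raises the in- and out-degree of its vertex together and vanishes modulo 2, so loops can
  -- pad a digraph to a regular one.
  loops : (Fin n → ℕ) → List (Fin n) → List Arc
  loops f = concatMap λ v → replicate (f v) (v , v)

  loops≈₂[] : ∀ f vs → loops f vs ≈₂ []
  loops≈₂[] f []       = ≈₂-refl
  loops≈₂[] f (v ∷ vs) = ≈₂-++ (copies (f v)) (loops≈₂[] f vs)
    where
    copies : ∀ m → replicate m (v , v) ≈₂ []
    copies zero    = ≈₂-refl
    copies (suc m) = ≈₂-trans ≈₂-loop (copies m)

  ∑-loops : ∀ f x {end : Arc → Fin n} → (∀ v → end (v , v) ≡ v) →
    ∑ (δ x ∘ end) (loops f (allFin n)) ≡ f x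
  ∑-loops f x {end} end≡ = begin
    ∑ (δ x ∘ end) (loops f (allFin n))                           ≡⟨ ∑-concatMap _ _ (allFin n) ⟩
    ∑ (λ v → ∑ (δ x ∘ end) (replicate (f v) (v , v))) (allFin n) ≡⟨ ∑-cong count (allFin n) ⟩
    ∑ (λ v → δ x v * f v) (allFin n)                             ≡⟨ ∑-δ f vertices! (∈-allFin x) ⟩
    f x                                                          ∎
    where
    open ≡-Reasoning
    count : ∀ v → ∑ (δ x ∘ end) (replicate (f v) (v , v)) ≡ δ x v * f v
    count v = ≡.trans (∑-replicate _ (f v) _)
      (≡.trans (cong (λ w → f v * δ x w) (end≡ v)) (*-comm (f v) _))

  record CycleCover (t : ℕ) (L : List Arc) : Set where
    field
      orientation  : BalancedOrientation L
      systems      : List (List Arc)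
      count        : length systems ≡ ⌊ t /2⌋
      systems↭     : ∃ λ f → concat systems ↭ oriented orientation ++ loops f (allFin n)
      cycleSystems : All CycleSystem systems

  cycleCover : ∀ t L → (∀ x → isOdd (deg x L) ≡ false) → (∀ x → deg x L ≤ t) → CycleCover t L
  cycleCover t L even bounded = record
    { orientation  = O
    ; systems      = proj₁ fact
    ; count        = proj₁ (proj₂ fact)
    ; systems↭     = f , proj₁ (proj₂ (proj₂ fact))
    ; cycleSystems = proj₂ (proj₂ (proj₂ fact))
    }
    where
    O : BalancedOrientation L
    O = balancedOrientation L
    D : List Arc
    D = oriented O
    out+in : ∀ x → out x D + in′ x D ≡ deg x L
    out+in x = ≡.trans (≡.sym (deg≡out+in x D))
      (≡.trans (deg-oriented x (forward O) (backward O)) (∑-↭ _ (arcs O)))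
    out≡in : ∀ x → out x D ≡ in′ x D
    out≡in x = even-sum⇒≡ _ _ (proj₁ (balancedAt (balanced O) x)) (proj₂ (balancedAt (balanced O) x))
      (≡.trans (cong isOdd (out+in x)) (even x))
    k : ℕ
    k = ⌊ t /2⌋
    -- Twice the out-degree is the degree, which is at most `t`.
    out≤k : ∀ x → out x D ≤ k
    out≤k x = subst (_≤ k) (≡.sym (n≡⌊n+n/2⌋ (out x D))) (⌊n/2⌋-mono
      (subst (_≤ t) (≡.trans (≡.sym (out+in x)) (cong (out x D +_) (≡.sym (out≡in x)))) (bounded x)))
    -- The number of loops missing to out-degree `k`; by `out≡in` they bring the in-degree to `k` as
    -- well.
    f : Fin n → ℕ
    f v = k ∸ out v D
    fact : Factorisation k (D ++ loops f (allFin n))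
    fact = factorisation k _
      (λ x → ≡.trans (∑-++ _ D _)
        (≡.trans (cong (out x D +_) (∑-loops f x (λ _ → ≡.refl))) (m+[n∸m]≡n (out≤k x))))
      (λ x → ≡.trans (∑-++ _ D _)
        (≡.trans (cong₂ _+_ (≡.sym (out≡in x)) (∑-loops f x (λ _ → ≡.refl))) (m+[n∸m]≡n (out≤k x))))

  oriented≈₂ : ∀ {L} (O : BalancedOrientation L) → oriented O ≈₂ L
  oriented≈₂ O = ≈₂-trans (≈₂-++ (≈₂-refl {forward O}) (≈₂-reverse (backward O))) (↭⇒≈₂ (arcs O))

  systems≈₂ : ∀ {t L} (Φ : CycleCover t L) → concat (CycleCover.systems Φ) ≈₂ L
  systems≈₂ {L = L} Φ = begin
    concat systems                                 ≈⟨ ↭⇒≈₂ (proj₂ systems↭) ⟩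
    oriented orientation ++ loops f (allFin n)     ≈⟨ ≈₂-++ (oriented≈₂ orientation) (loops≈₂[] f (allFin n)) ⟩
    L ++ []                                        ≡⟨ ++-identityʳ L ⟩
    L                                              ∎
    where
    open CycleCover Φ
    open SetoidReasoning ≈₂-setoid
    f : Fin n → ℕ
    f = proj₁ systems↭

  pathCover : ∀ {cs} → All CycleSystem cs →
    ∃ λ ps → length ps ≡ length cs + length cs × pathArcs ps ≈₂ concat cs
  pathCover []                  = [] , ≡.refl , ≈₂-refl
  pathCover {C ∷ cs} (S ∷ Ss)
    with twoPaths Q R Q! R! _ _ cov _ ← twoPathsOf (length C) C ≤-refl S
    with ps , len , cov′ ← pathCover Ss
    = record { verts = Q ; distinct = Q! } ∷ record { verts = R ; distinct = R! } ∷ ps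
    , cong suc (≡.trans (cong suc len) (≡.sym (+-suc (length cs) _)))
    , ≈₂-trans (↭⇒≈₂ (↭-reflexive (≡.sym (++-assoc (steps Q) _ _)))) (≈₂-++ cov cov′)

  -- One arc of a cycle system can be left out: it is the first step of one of the two paths.
  pathCoverWithout : ∀ {cs a} → All CycleSystem cs → a ∈ concat cs →
    ∃ λ ps → length ps ≡ length cs + length cs × (a ∷ pathArcs ps) ≈₂ concat cs
  pathCoverWithout {C ∷ cs} {a@(b , x)} (S ∷ Ss) a∈ with ∈-++⁻ C a∈
  ... | inj₂ a∈cs
    with twoPaths Q R Q! R! _ _ cov _ ← twoPathsOf (length C) C ≤-refl S
    with ps , len , cov′ ← pathCoverWithout Ss a∈cs
    = record { verts = Q ; distinct = Q! } ∷ record { verts = R ; distinct = R! } ∷ ps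
    , cong suc (≡.trans (cong suc len) (≡.sym (+-suc (length cs) _)))
    , ≈₂-trans (↭⇒≈₂ (↭-trans (↭-reflexive (cong (a ∷_) (≡.sym (++-assoc (steps Q) _ _))))
                               (↭-sym (shift a (steps Q ++ steps R) _))))
               (≈₂-++ cov cov′)
  ... | inj₁ a∈C
    -- Without its arc from `b` to `x`, `C` is a path system from `x` to `b`. The paths starting at
    -- `x` and at `b` cover it without the step that `close` would add.
    with C′ , C↭ ← ∈⇒↭ a∈C
    with twoPathsFrom Q R Q! R! _ _ cov ← twoPathsFromTo (length C′) C′ ≤-refl
           (pathSystem (Unique-resp-↭ (map⁺ proj₂ C↭) (CycleSystem.targets! S))
             (↭-trans (↭-sym (map⁺ proj₁ C↭)) (↭-trans (CycleSystem.sources↭targets S) (map⁺ proj₂ C↭))))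
    with ps , len , cov′ ← pathCover Ss
    = record { verts = x ∷ Q ; distinct = Q! } ∷ record { verts = b ∷ R ; distinct = R! } ∷ ps
    , cong suc (≡.trans (cong suc len) (≡.sym (+-suc (length cs) _)))
    , assocˡ (steps (x ∷ Q)) (≈₂-++ (≈₂-trans (≈₂-∷ cov) (↭⇒≈₂ (↭-sym C↭))) cov′)
    where
    assocˡ : ∀ L₁ {L₂ L₃ L} → ((a ∷ (L₁ ++ L₂)) ++ L₃) ≈₂ L → (a ∷ (L₁ ++ (L₂ ++ L₃))) ≈₂ L
    assocˡ L₁ p = ≈₂-trans (↭⇒≈₂ (↭-reflexive (cong (a ∷_) (≡.sym (++-assoc L₁ _ _))))) p

  -- Assembling and counting the paths.

  eulerianCover : ∀ {t L} → CycleCover t L → ∃ λ ps → pathArcs ps ≈₂ L × length ps ≤ t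
  eulerianCover {t} Φ = let ps , len , ≈cs = pathCover cycleSystems in
    ps , ≈₂-trans ≈cs (systems≈₂ Φ) ,
    subst (_≤ t) (≡.sym (≡.trans len (cong₂ _+_ count count))) (halves≤ t)
    where
    open CycleCover Φ

  -- The cycle systems give at most `suc t` paths and `M` gives one for each of its edges. The path
  -- saved for `a` pays for raising the degree bound by one.
  augmentedCover : ∀ {t a M L} → CycleCover (suc t) (a ∷ M ++ L) →
    ∃ λ ps → pathArcs ps ≈₂ L × length ps ≤ t + suc (length M)
  augmentedCover {t} {a} {M} {L} Φ =
    [ without (≈₂-refl {a ∷ []}) , without (≈₂-swap a {[]}) ]′ located
    where
    open CycleCover Φ

    fromOriented : ∀ {c} → c ∈ oriented orientation → c ∈ concat systems
    fromOriented c∈ = ∈-resp-↭ (↭-sym (proj₂ systems↭)) (∈-++⁺ˡ c∈)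

    -- The orientation may have reversed `a`.
    located : a ∈ concat systems ⊎ Product.swap a ∈ concat systems
    located with ∈-++⁻ (forward orientation) (∈-resp-↭ (↭-sym (arcs orientation)) (here ≡.refl))
    ... | inj₁ a∈ = inj₁ (fromOriented (∈-++⁺ˡ a∈))
    ... | inj₂ a∈ = inj₂ (fromOriented (∈-++⁺ʳ (forward orientation) (∈-map⁺ Product.swap a∈)))

    without : ∀ {c} → (c ∷ []) ≈₂ (a ∷ []) → c ∈ concat systems →
      ∃ λ ps → pathArcs ps ≈₂ L × length ps ≤ t + suc (length M)
    without {c} c≈a c∈ with pathCoverWithout cycleSystems c∈
    ... | ps , len , ≈cs = map edgePath M ++ ps , eq , le
      where
      -- Of the two inserted copies of `a`, one, as `c`, completes the cycle systems, and the other
      -- cancels the `a` in their sum.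
      remaining : pathArcs ps ≈₂ (M ++ L)
      remaining = begin
        pathArcs ps            ≈⟨ drop-double ⟨
        a ∷ a ∷ pathArcs ps    ≈⟨ ≈₂-∷ (≈₂-++ (≈₂-sym c≈a) (≈₂-refl {pathArcs ps})) ⟩
        a ∷ c ∷ pathArcs ps    ≈⟨ ≈₂-∷ (≈₂-trans ≈cs (systems≈₂ Φ)) ⟩
        a ∷ a ∷ M ++ L         ≈⟨ drop-double ⟩
        M ++ L                 ∎
        where open SetoidReasoning ≈₂-setoid
      eq : pathArcs (map edgePath M ++ ps) ≈₂ L
      eq = begin
        pathArcs (map edgePath M ++ ps)            ≡⟨ concatMap-++ (steps ∘ verts) (map edgePath M) ps ⟩
        pathArcs (map edgePath M) ++ pathArcs ps   ≈⟨ ≈₂-++ (pathArcs-edgePath M) remaining ⟩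
        M ++ M ++ L                                ≡⟨ ++-assoc M M L ⟨
        (M ++ M) ++ L                              ≈⟨ ≈₂-++ (++-self M) ≈₂-refl ⟩
        L                                          ∎
        where open SetoidReasoning ≈₂-setoid
      le : length (map edgePath M ++ ps) ≤ t + suc (length M)
      le = begin
        length (map edgePath M ++ ps)
          ≡⟨ length-++ (map edgePath M) ⟩
        length (map edgePath M) + length ps
          ≡⟨ cong₂ _+_ (length-map edgePath M) (≡.trans len (cong₂ _+_ count count)) ⟩
        length M + (⌊ suc t /2⌋ + ⌊ suc t /2⌋)
          ≤⟨ +-monoʳ-≤ (length M) (halves≤ (suc t)) ⟩
        length M + suc t
          ≡⟨ +-comm (length M) _ ⟩
        suc t + length M
          ≡⟨ +-suc t _ ⟨
        t + suc (length M)
          ∎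
        where open ≤-Reasoning

  -- With no extra edge there is no path to save, and for odd `t` the bound `suc t` could cost one
  -- path too many; hence the separate case.
  coverFrom : ∀ t M L → (∀ x → isOdd (deg x (M ++ L)) ≡ false) →
    (∀ x → deg x L ≤ t) → (∀ x → deg x (M ++ L) ≤ suc t) →
    ∃ λ ps → pathArcs ps ≈₂ L × length ps ≤ t + length M
  coverFrom t []      L even bounded _        =
    let ps , eq , le = eulerianCover (cycleCover t L even bounded) in ps , eq , ≤-trans le (m≤m+n t 0)
  coverFrom t (a ∷ M) L even _       bounded =
    augmentedCover {M = M} (cycleCover (suc t) (a ∷ M ++ L) even bounded)

-- The edge list of a graph and its odd vertices.

module EdgeLists {n : ℕ} (G : Graph n) where
  open Occurrences {Fin n} Fin._≟_
  open Digraph {Fin n} Fin._≟_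
  open PathCovers n
  open Factorisations n

  -- Keeping only the direction from the smaller to the larger vertex lists every edge once.
  below : Fin n → Fin n → Bool
  below a b = does (a Fin.<? b) ∧ adj G a b

  below+above : ∀ a b → ι (below a b) + ι (below b a) ≡ ι (adj G a b)
  below+above a b = compare (a Fin.<? b) (b Fin.<? a)
    where
    compare : (a<b? : Dec (a Fin.< b)) (b<a? : Dec (b Fin.< a)) →
      ι (does a<b? ∧ adj G a b) + ι (does b<a? ∧ adj G b a) ≡ ι (adj G a b)
    compare (yes a<b) (yes b<a) = contradiction b<a (<-asym a<b)
    compare (yes _)   (no _)    = +-identityʳ _
    compare (no _)    (yes _)   = cong ι (Graph.sym G b a)
    -- Here `a` and `b` coincide, and irreflexivity makes both sides 0.
    compare (no a≮b)  (no b≮a)  with Fin.toℕ-injective (≤-antisym (≮⇒≥ b≮a) (≮⇒≥ a≮b))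
    ... | ≡.refl = cong ι (≡.sym (irrefl G a))

  edges : List Arc
  edges = filterᵇ (λ (a , b) → below a b) (cartesianProduct (allFin n) (allFin n))

  ∑-edges : (h : Arc → ℕ) →
    ∑ h edges ≡ ∑ (λ a → ∑ (λ b → ι (below a b) * h (a , b)) (allFin n)) (allFin n)
  ∑-edges h = ≡.trans (∑-filterᵇ h _ (cartesianProduct (allFin n) (allFin n)))
                      (∑-cartesianProduct _ (allFin n) (allFin n))

  ∑-δ-vertices : ∀ x (f : Fin n → ℕ) → ∑ (λ y → δ x y * f y) (allFin n) ≡ f x
  ∑-δ-vertices x f = ∑-δ f vertices! (∈-allFin x)

  out-edges : ∀ x → out x edges ≡ ∑ (λ b → ι (below x b)) (allFin n)
  out-edges x = begin
    out x edges
      ≡⟨ ∑-edges _ ⟩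
    ∑ (λ a → ∑ (λ b → ι (below a b) * δ x a) (allFin n)) (allFin n)
      ≡⟨ ∑-cong (λ a → ∑-cong (λ b → *-comm (ι (below a b)) (δ x a)) (allFin n)) (allFin n) ⟩
    ∑ (λ a → ∑ (λ b → δ x a * ι (below a b)) (allFin n)) (allFin n)
      ≡⟨ ∑-cong (λ a → ∑-* (δ x a) _ (allFin n)) (allFin n) ⟩
    ∑ (λ a → δ x a * ∑ (λ b → ι (below a b)) (allFin n)) (allFin n)
      ≡⟨ ∑-δ-vertices x _ ⟩
    ∑ (λ b → ι (below x b)) (allFin n)
      ∎
    where open ≡-Reasoning

  in-edges : ∀ x → in′ x edges ≡ ∑ (λ a → ι (below a x)) (allFin n)
  in-edges x = ≡.trans (∑-edges _) (∑-cong inner (allFin n))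
    where
    inner : ∀ a → ∑ (λ b → ι (below a b) * δ x b) (allFin n) ≡ ι (below a x)
    inner a = ≡.trans (∑-cong (λ b → *-comm (ι (below a b)) (δ x b)) (allFin n)) (∑-δ-vertices x _)

  degree-∑ : ∀ x →
    degree G x ≡ ∑ (λ b → ι (below x b)) (allFin n) + ∑ (λ a → ι (below a x)) (allFin n)
  degree-∑ x = ≡.trans (countB-∑ (adj G x) (allFin n))
    (≡.trans (∑-cong (λ b → ≡.sym (below+above x b)) (allFin n)) (∑-+ _ _ (allFin n)))

  deg-edges : ∀ x → deg x edges ≡ degree G x
  deg-edges x = ≡.trans (deg≡out+in x edges)
    (≡.trans (cong₂ _+_ (out-edges x) (in-edges x)) (≡.sym (degree-∑ x)))

  -- Bridges the opposite orders in which `δ` and `joins` compare vertices.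
  δ≡ι : ∀ u a → δ u a ≡ ι ⌊ a Fin.≟ u ⌋
  δ≡ι u a with u Fin.≟ a | a Fin.≟ u
  ... | yes _   | yes _   = ≡.refl
  ... | no _    | no _    = ≡.refl
  ... | yes u≡a | no a≢u  = contradiction (≡.sym u≡a) a≢u
  ... | no u≢a  | yes a≡u = contradiction (≡.sym a≡u) u≢a

  -- For different `u` and `v` the two alternatives in `joins` exclude each other, so the
  -- disjunction becomes a sum.
  joins-δ : ∀ {u v} a b → u ≢ v → ι (joins u v (a , b)) ≡ δ u a * δ v b + δ v a * δ u b
  joins-δ {u} {v} a b u≢v
    rewrite δ≡ι u a | δ≡ι v b | δ≡ι v a | δ≡ι u b
    with a Fin.≟ u | a Fin.≟ v
  ... | yes ≡.refl | yes ≡.refl = contradiction ≡.refl u≢v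
  ... | no _       | no _       = ≡.refl
  ... | no _       | yes _      = ≡.sym (+-identityʳ _)
  ... | yes _      | no _       with b Fin.≟ v
  ...   | yes _ = ≡.refl
  ...   | no _  = ≡.refl

  -- Evaluating the deltas leaves the two possible listings `(u , v)` and `(v , u)`, of which
  -- exactly one occurs if `u` and `v` are adjacent, and none otherwise.
  mult-edges : ∀ {u v} → u ≢ v → mult u v edges ≡ ι (adj G u v)
  mult-edges {u} {v} u≢v = begin
    mult u v edges
      ≡⟨ ∑-edges _ ⟩
    ∑ (λ a → ∑ (λ b → ι (below a b) * ι (joins u v (a , b))) (allFin n)) (allFin n)
      ≡⟨ ∑-cong (λ a → ∑-cong (λ b → expand a b) (allFin n)) (allFin n) ⟩
    ∑ (λ a → ∑ (λ b → δ u a * (δ v b * ι (below a b)) + δ v a * (δ u b * ι (below a b))) (allFin n)) (allFin n)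
      ≡⟨ ∑-cong (λ a → collapse a) (allFin n) ⟩
    ∑ (λ a → δ u a * ι (below a v) + δ v a * ι (below a u)) (allFin n)
      ≡⟨ ∑-+ _ _ (allFin n) ⟩
    ∑ (λ a → δ u a * ι (below a v)) (allFin n) + ∑ (λ a → δ v a * ι (below a u)) (allFin n)
      ≡⟨ cong₂ _+_ (∑-δ-vertices u _) (∑-δ-vertices v _) ⟩
    ι (below u v) + ι (below v u)
      ≡⟨ below+above u v ⟩
    ι (adj G u v)
      ∎
    where
    open ≡-Reasoning
    expand : ∀ a b → ι (below a b) * ι (joins u v (a , b)) ≡
      δ u a * (δ v b * ι (below a b)) + δ v a * (δ u b * ι (below a b))
    expand a b = begin
      ι (below a b) * ι (joins u v (a , b))
        ≡⟨ *-comm (ι (below a b)) _ ⟩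
      ι (joins u v (a , b)) * ι (below a b)
        ≡⟨ cong (_* ι (below a b)) (joins-δ a b u≢v) ⟩
      (δ u a * δ v b + δ v a * δ u b) * ι (below a b)
        ≡⟨ *-distribʳ-+ (ι (below a b)) (δ u a * δ v b) _ ⟩
      δ u a * δ v b * ι (below a b) + δ v a * δ u b * ι (below a b)
        ≡⟨ cong₂ _+_ (*-assoc (δ u a) _ _) (*-assoc (δ v a) _ _) ⟩
      δ u a * (δ v b * ι (below a b)) + δ v a * (δ u b * ι (below a b))
        ∎
    collapse₁ : ∀ x y a → ∑ (λ b → δ x a * (δ y b * ι (below a b))) (allFin n) ≡ δ x a * ι (below a y)
    collapse₁ x y a = ≡.trans (∑-* (δ x a) _ (allFin n)) (cong (δ x a *_) (∑-δ-vertices y _))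
    collapse : ∀ a →
      ∑ (λ b → δ u a * (δ v b * ι (below a b)) + δ v a * (δ u b * ι (below a b))) (allFin n) ≡
      δ u a * ι (below a v) + δ v a * ι (below a u)
    collapse a = ≡.trans (∑-+ _ _ (allFin n)) (cong₂ _+_ (collapse₁ u v a) (collapse₁ v u a))

  -- Every edge is counted once at its smaller and once at its larger end; exchanging the order of
  -- summation shows that both totals agree.
  handshake : isOdd (vOdd G) ≡ false
  handshake = begin
    isOdd (vOdd G)                               ≡⟨ cong isOdd (countB-∑ _ (allFin n)) ⟩
    isOdd (∑ (ι ∘ isOdd ∘ degree G) (allFin n))  ≡⟨ isOdd-∑ (degree G) (allFin n) ⟩
    isOdd (∑ (degree G) (allFin n))              ≡⟨ cong isOdd (∑-cong degree-∑ (allFin n)) ⟩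
    isOdd (∑ (λ x → outs x + ins x) (allFin n))  ≡⟨ cong isOdd (∑-+ outs ins (allFin n)) ⟩
    isOdd (arcs# + ∑ ins (allFin n))             ≡⟨ cong (λ s → isOdd (arcs# + s))
                                                      (∑-exchange (λ x a → ι (below a x)) (allFin n) (allFin n)) ⟩
    isOdd (arcs# + arcs#)                        ≡⟨ isOdd-double arcs# ⟩
    false                                        ∎
    where
    open ≡-Reasoning
    outs ins : Fin n → ℕ
    outs x = ∑ (λ b → ι (below x b)) (allFin n)
    ins x = ∑ (λ a → ι (below a x)) (allFin n)
    arcs# : ℕ
    arcs# = ∑ outs (allFin n)

  oddVertices : List (Fin n)
  oddVertices = filterᵇ (isOdd ∘ degree G) (allFin n)

  length-oddVertices : length oddVertices ≡ vOdd G
  length-oddVertices = length-filterᵇ _ (allFin n)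

  ∑-δ-oddVertices : ∀ x → ∑ (δ x) oddVertices ≡ ι (isOdd (degree G x))
  ∑-δ-oddVertices x = ≡.trans (∑-filterᵇ (δ x) _ (allFin n))
    (≡.trans (∑-cong (λ y → *-comm (ι (isOdd (degree G y))) (δ x y)) (allFin n)) (∑-δ-vertices x _))

  deg-pairUp : ∀ x xs → isOdd (length xs) ≡ false → deg x (pairUp xs) ≡ ∑ (δ x) xs
  deg-pairUp x []           even = ≡.refl
  deg-pairUp x (y ∷ [])     ()
  deg-pairUp x (y ∷ z ∷ xs) even =
    ≡.trans (cong (δ x y + δ x z +_) (deg-pairUp x xs (≡.trans (≡.sym (not-involutive _)) even)))
            (+-assoc (δ x y) _ _)

  -- A pair may repeat an edge of `G`; arc lists keep multiplicities, so the augmented graph is a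
  -- multigraph.
  oddPairs : List Arc
  oddPairs = pairUp oddVertices

  even-oddVertices : isOdd (length oddVertices) ≡ false
  even-oddVertices = ≡.trans (cong isOdd length-oddVertices) handshake

  -- The division is exact by `handshake`.
  length-oddPairs : length oddPairs ≡ vOdd G / 2
  length-oddPairs = begin
    length oddPairs          ≡⟨ m*n/n≡m (length oddPairs) 2 ⟨
    length oddPairs * 2 / 2  ≡⟨ cong (_/ 2) (length-pairUp oddVertices even-oddVertices) ⟨
    length oddVertices / 2   ≡⟨ cong (_/ 2) length-oddVertices ⟩
    vOdd G / 2               ∎
    where open ≡-Reasoning

  -- A vertex of odd degree lies in exactly one pair, any other vertex in none.
  deg-augmented : ∀ x → deg x (oddPairs ++ edges) ≡ ι (isOdd (degree G x)) + degree G x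
  deg-augmented x = ≡.trans (∑-++ _ oddPairs edges)
    (cong₂ _+_ (≡.trans (deg-pairUp x oddVertices even-oddVertices) (∑-δ-oddVertices x)) (deg-edges x))

  even-augmented : ∀ x → isOdd (deg x (oddPairs ++ edges)) ≡ false
  even-augmented x = ≡.trans (cong isOdd (deg-augmented x))
    (≡.trans (isOdd-+ (ι (isOdd (degree G x))) (degree G x))
      (≡.trans (cong (_xor isOdd (degree G x)) (isOdd-ι (isOdd (degree G x)))) (xor-same (isOdd (degree G x)))))

  degree≤maxDegree : ∀ x → degree G x ≤ maxDegree G
  degree≤maxDegree x = bound (∈-allFin x)
    where
    bound : ∀ {xs} → x ∈ xs → degree G x ≤ foldr (λ v m → degree G v ⊔ m) 0 xs
    bound (here ≡.refl)       = m≤m⊔n (degree G x) _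
    bound {y ∷ _} (there x∈) = ≤-trans (bound x∈) (m≤n⊔m (degree G y) _)

  cover : ∀ ps → pathArcs ps ≈₂ edges → IsPathOddCover G ps
  cover ps eq u v u≢v = begin
    isOdd (countB (λ P → hasEdge u v (verts P)) ps)  ≡⟨ cong isOdd (countB-hasEdge u v ps) ⟩
    isOdd (mult u v (pathArcs ps))                   ≡⟨ parity eq u v u≢v ⟩
    isOdd (mult u v edges)                           ≡⟨ cong isOdd (mult-edges u≢v) ⟩
    isOdd (ι (adj G u v))                            ≡⟨ isOdd-ι (adj G u v) ⟩
    adj G u v                                        ∎
    where open ≡-Reasoning

  deg-edges≤ : ∀ x → deg x edges ≤ maxDegree G
  deg-edges≤ x = subst (_≤ maxDegree G) (≡.sym (deg-edges x)) (degree≤maxDegree x)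

  deg-augmented≤ : ∀ x → deg x (oddPairs ++ edges) ≤ suc (maxDegree G)
  deg-augmented≤ x = subst (_≤ suc (maxDegree G)) (≡.sym (deg-augmented x))
    (+-mono-≤ (ι≤1 (isOdd (degree G x))) (degree≤maxDegree x))
    where
    ι≤1 : ∀ b → ι b ≤ 1
    ι≤1 true  = s≤s z≤n
    ι≤1 false = z≤n

theorem3p1 : ∀ (n : ℕ) (G : Graph n) →
    Σ (List (Path n)) (λ ps → IsPathOddCover G ps × length ps ≤ maxDegree G + vOdd G / 2)
theorem3p1 n G =
  let ps , eq , le = coverFrom (maxDegree G) oddPairs edges
        even-augmented deg-edges≤ deg-augmented≤ in
  ps , cover ps eq , subst (λ m → length ps ≤ maxDegree G + m) length-oddPairs le
  where
  open Factorisations n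
  open EdgeLists G
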